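{- Let $\mathfrak B$ be the set of the twelve tournaments $C_3.\omega$, $C_3.\omega^*$, $V_{[\omega]}$, $V_{[\omega^*]}$, $T_{[\omega]}$, $T_{[\omega^*]}$, $U_{[\omega]}$, $U_{[\omega^*]}$, $H_{[\omega]}$, $H_{[\omega^*]}$, $K_{[\omega]}$, $K_{[\omega^*]}$, and let $\check K_{[\omega]}$ denote the tournament induced by $K_{[\omega]}$ on its vertex set minus the vertex $(0,0)$. The twelve tournaments obtained from $\mathfrak B$ by replacing $K_{[\omega]}$ by $\check K_{[\omega]}$ are infinite acyclically indecomposable tournaments, and every infinite acyclically indecomposable tournament contains a subtournament isomorphic to one of these twelve tournaments.
   Context: A tournament is a set with an irreflexive, antisymmetric, complete binary relation (edges, written $u\to v$). It is acyclic if it has no $3$-cycle. A subset $A$ of vertices is autonomous if every vertex outside $A$ either dominates all of $A$ or is dominated by all of $A$. A tournament is acyclically indecomposable if no autonomous subset inducing an acyclic tournament has more than one element. A subtournament is the tournament induced on a subset of vertices. For a chain (acyclic tournament) $C=(A,<)$ (edge $x\to y$ iff $x<y$) define: - $C_3.C$: vertex set $A\times\{0,1,2\}$, with $(x,i)\to(y,j)$ iff $x<y$, or $x=y$ and $j\equiv i+1 \pmod 3$ (copies of the $3$-cycle arranged along $C$). - $V_{[C]}$: vertex set $(A\times\{0,1\})\cup\{a\}$ with $a$ a new vertex; $(x,i)\to(x',i')$ iff $x<x'$ or ($x=x'$ and $i<i'$); and $a\to(x,0)$, $(x,1)\to a$ for all $x\in A$. - $T_{[C]},U_{[C]},H_{[C]},K_{[C]}$: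 vertex set $A\times\{0,1\}$; in all four, $(x,0)\to(x,1)$ for every $x\in A$ and $(x,0)\to(y,0)$ whenever $x<y$; in addition, for all $x<y$ in $A$: $T_{[C]}$: $(x,1)\to(y,1)$, $(y,1)\to(x,0)$, $(y,0)\to(x,1)$; $U_{[C]}$: $(y,1)\to(x,1)$, $(x,0)\to(y,1)$, $(x,1)\to(y,0)$; $H_{[C]}$: $(x,1)\to(y,1)$, $(y,1)\to(x,0)$, $(x,1)\to(y,0)$; $K_{[C]}$: $(y,1)\to(x,1)$, $(y,1)\to(x,0)$, $(x,1)\to(y,0)$. Here $\omega=(\mathbb N,<)$ and $\omega^*$ is its dual ($\mathbb N$ with the reversed order). -}

module Defs where

open import Data.Nat using (ℕ; zero; suc; _<_)
open import Data.Fin using (Fin; zero; suc)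
open import Data.Bool using (Bool; true; false; not; T)
open import Data.Maybe using (Maybe; just; nothing)
open import Data.Product using (Σ; ∃-syntax; _×_; _,_)
open import Data.Sum using (_⊎_)
open import Data.Empty using (⊥)
open import Relation.Nullary using (¬_; Dec)
open import Relation.Binary.PropositionalEquality using (_≡_; _≢_)
open import Function.Bundles using (_↔_; _⇔_)
open import Function.Definitions using (Injective)

record Digraph : Set₁ where
  field
    V   : Set
    _⇒_ : V → V → Set

open Digraph public

IsTournament : Digraph → Set
IsTournament D =
    (∀ u → ¬ (_⇒_ D u u))
  × (∀ u v → _⇒_ D u v → ¬ (_⇒_ D v u))
  × (∀ u v → u ≢ v → _⇒_ D u v ⊎ _⇒_ D v u)

Subset : Digraph → Set₁
Subset D = V D → Set

AcyclicOn : (D : Digraph) → Subset D → Set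
AcyclicOn D A = ¬ (Σ (V D) λ x → Σ (V D) λ y → Σ (V D) λ z →
  A x × A y × A z × _⇒_ D x y × _⇒_ D y z × _⇒_ D z x)

Autonomous : (D : Digraph) → Subset D → Set
Autonomous D A = ∀ w → ¬ A w →
  (∀ a → A a → _⇒_ D w a) ⊎ (∀ a → A a → _⇒_ D a w)

AcyclicallyIndecomposable : Digraph → Set₁
AcyclicallyIndecomposable D = ∀ (A : Subset D) → Autonomous D A → AcyclicOn D A →
  ∀ x y → A x → A y → x ≡ y

Finite : Digraph → Set
Finite D = ∃[ n ] (V D ↔ Fin n)

Infinite : Digraph → Set
Infinite D = ¬ Finite D

record Embeds (S D : Digraph) : Set where
  field
    f      : V S → V D
    inj    : Injective _≡_ _≡_ f
    edges  : ∀ u v → (_⇒_ S u v ⇔ _⇒_ D (f u) (f v))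

Induced : (D : Digraph) → Subset D → Digraph
Induced D A = record { V = Σ (V D) A ; _⇒_ = λ { (u , _) (v , _) → _⇒_ D u v } }

succ3 : Fin 3 → Fin 3
succ3 zero = suc zero
succ3 (suc zero) = suc (suc zero)
succ3 (suc (suc zero)) = zero

C3dot : (A : Set) → (A → A → Set) → Digraph
C3dot A _<ᶜ_ = record
  { V = A × Fin 3
  ; _⇒_ = λ { (x , i) (y , j) → (x <ᶜ y) ⊎ (x ≡ y × j ≡ succ3 i) } }

_<₂_ : Fin 2 → Fin 2 → Set
i <₂ j = i ≡ zero × j ≡ suc zero

-- V_[C] ; the new vertex a is `nothing`, (x , i) is `just (x , i)`
VC : (A : Set) → (A → A → Set) → Digraph
VC A _<ᶜ_ = record { V = Maybe (A × Fin 2) ; _⇒_ = E }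
  where
  E : Maybe (A × Fin 2) → Maybe (A × Fin 2) → Set
  E (just (x , i)) (just (x' , i')) = (x <ᶜ x') ⊎ (x ≡ x' × i <₂ i')
  E nothing (just (x , i)) = i ≡ zero
  E (just (x , i)) nothing = i ≡ suc zero
  E nothing nothing = ⊥

-- Generic two-layer construction on A × {0,1}.
-- fwd i j = true means: for x <ᶜ y, the edge goes (x , i) → (y , j);
-- fwd i j = false means: (y , j) → (x , i).  Also (x , 0) → (x , 1).
TwoLayer : (Fin 2 → Fin 2 → Bool) → (A : Set) → (A → A → Set) → Digraph
TwoLayer fwd A _<ᶜ_ = record
  { V = A × Fin 2
  ; _⇒_ = λ { (x , i) (y , j) →
        (x ≡ y × i <₂ j)
      ⊎ (x <ᶜ y × T (fwd i j))
      ⊎ (y <ᶜ x × T (not (fwd j i))) } }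

fwdT : Fin 2 → Fin 2 → Bool
fwdT zero zero = true
fwdT (suc zero) (suc zero) = true
fwdT zero (suc zero) = false
fwdT (suc zero) zero = false

fwdU : Fin 2 → Fin 2 → Bool
fwdU zero zero = true
fwdU (suc zero) (suc zero) = false
fwdU zero (suc zero) = true
fwdU (suc zero) zero = true

fwdH : Fin 2 → Fin 2 → Bool
fwdH zero zero = true
fwdH (suc zero) (suc zero) = true
fwdH zero (suc zero) = false
fwdH (suc zero) zero = true

fwdK : Fin 2 → Fin 2 → Bool
fwdK zero zero = true
fwdK (suc zero) (suc zero) = false
fwdK zero (suc zero) = false
fwdK (suc zero) zero = true

TC UC HC KC : (A : Set) → (A → A → Set) → Digraph
TC = TwoLayer fwdT
UC = TwoLayer fwdU
HC = TwoLayer fwdH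
KC = TwoLayer fwdK

_<ω_ : ℕ → ℕ → Set
x <ω y = x < y

_<ω*_ : ℕ → ℕ → Set
x <ω* y = y < x

KCheckω : Digraph
KCheckω = Induced (KC ℕ _<ω_) (λ v → v ≢ (0 , zero))

data Basic : Set where
  c3ω c3ω* vω vω* tω tω* uω uω* hω hω* ǩω kω* : Basic

basic : Basic → Digraph
basic c3ω  = C3dot ℕ _<ω_
basic c3ω* = C3dot ℕ _<ω*_
basic vω   = VC ℕ _<ω_
basic vω*  = VC ℕ _<ω*_
basic tω   = TC ℕ _<ω_
basic tω*  = TC ℕ _<ω*_
basic uω   = UC ℕ _<ω_
basic uω*  = UC ℕ _<ω*_
basic hω   = HC ℕ _<ω_
basic hω*  = HC ℕ _<ω*_
basic ǩω   = KCheckω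
basic kω*  = KC ℕ _<ω*_

ExcludedMiddle : Set₁
ExcludedMiddle = (P : Set) → Dec P

module Submission where

-- Call an edge x → y linked if some 3-cycle has at least two vertices in the interval from x to y.
-- A tournament is acyclically indecomposable iff every edge is linked, which for the twelve
-- tournaments is checked edge by edge.
--
-- Conversely, by Ramsey an infinite tournament contains, up to duality, a chain x₀ → x₁ → … of
-- type ω in which either all pairs or no pairs lie in a 3-cycle. Linking x₂ᵢ → x₂ᵢ₊₁ gives 3-cycles
-- uᵢ → vᵢ → wᵢ → uᵢ with uᵢ and vᵢ in that interval; in both cases every uᵢ and vᵢ is placed with
-- respect to the other intervals as its own endpoints are (in the second because otherwise a pair
-- of chain elements would lie in a 3-cycle). By Ramsey again, the direction of the edges between
-- index i and index j > i depends only on the letters. Either the uᵢ and vᵢ form the chain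
-- u₀ → v₀ → u₁ → v₁ → …, and the position of the wᵢ yields C₃, V or a two-layer tournament, or
-- they do not, and together with the x₂ᵢ they already yield V or a two-layer tournament.

open import Defs
open import Data.Bool using (Bool; true; false; not; T; _∧_; _∨_)
open import Data.Empty using (⊥-elim)
open import Data.Fin using (Fin; zero; suc)
open import Data.Fin.Patterns using (0F; 1F; 2F)
open import Data.Fin.Properties using (ℕ→Fin-notInjective)
open import Data.List using (List; []; _∷_; length; lookup; allFin; cartesianProduct)
open import Data.List.Membership.Propositional using (_∈_; _∉_)
open import Data.List.Membership.Propositional.Properties
  using (∈-allFin; ∈-cartesianProduct⁺; ∈-lookup)
open import Data.List.Relation.Unary.All as All using ([])
open import Data.List.Relation.Unary.AllPairs using ([]; _∷_)
open import Data.List.Relation.Unary.Any using (here; there; index)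
open import Data.List.Relation.Unary.Any.Properties using (lookup-index)
open import Data.List.Relation.Unary.Unique.Propositional using (Unique)
open import Data.Maybe using (Maybe; just; nothing)
open import Data.Nat
  using (ℕ; zero; suc; _+_; _<_; _≤_; _≤′_; ≤′-refl; ≤′-step; z<s; s<s; s≤s)
open import Data.Nat.Properties
  using (<-isStrictTotalOrder; <-trans; n<1+n; m<n⇒m<1+n; m<1+n⇒m<n∨m≡n; m≤n⇒m<n∨m≡n;
         m≤n+m; +-monoˡ-<; ≤⇒≤′)
open import Data.Product using (Σ; Σ-syntax; ∃-syntax; _×_; _,_; proj₁; proj₂)
open import Data.Sum using (_⊎_; inj₁; inj₂; swap)
open import Data.Unit using (tt)
open import Function using (_∘_; flip; id)
open import Function.Bundles using (module Inverse; mk⇔; mk↔ₛ′)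
open import Function.Definitions using (Injective)
open import Relation.Binary using (IsStrictTotalOrder; tri<; tri≈; tri>)
open import Relation.Binary.Construct.Flip.EqAndOrd using ()
  renaming (isStrictTotalOrder to flip-isStrictTotalOrder)
open import Relation.Binary.PropositionalEquality
  using (_≡_; _≢_; refl; sym; trans; cong; subst)
open import Relation.Nullary using (¬_; yes; no)

-- Linked edges and autonomous acyclic sets

Between : (D : Digraph) → V D → V D → V D → Set
Between D x y z = z ≡ x ⊎ z ≡ y ⊎ (_⇒_ D x z × _⇒_ D z y)

-- For x → y this fails exactly when x and y lie in a common autonomous acyclic subset,
-- in which case {z | Between D x y z} is the smallest one.
Link : (D : Digraph) → V D → V D → Set
Link D x y = Σ[ u ∈ V D ] Σ[ v ∈ V D ] Σ[ w ∈ V D ]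
  Between D x y u × Between D x y v × _⇒_ D u v × _⇒_ D v w × _⇒_ D w u

AllLinked : Digraph → Set
AllLinked D = ∀ x y → _⇒_ D x y → Link D x y

pattern left      = inj₁ refl
pattern right     = inj₂ (inj₁ refl)
pattern inner p q = inj₂ (inj₂ (p , q))

module _ (em : ExcludedMiddle) (D : Digraph) (tournament : IsTournament D) where
  private
    _⟶_ : V D → V D → Set
    _⟶_ = _⇒_ D
    irr      = proj₁ tournament
    asym     = proj₁ (proj₂ tournament)
    complete = proj₂ (proj₂ tournament)

  module _ (A : Subset D) (autonomous : Autonomous D A) where

    autonomous-convex : ∀ {x y z} → A x → A y → Between D x y z → A z
    autonomous-convex Ax Ay left  = Ax
    autonomous-convex Ax Ay right = Ay
    autonomous-convex {z = z} Ax Ay (inner p q) with em (A z)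
    ... | yes Az = Az
    ... | no ¬Az with autonomous z ¬Az
    ...   | inj₁ to   = ⊥-elim (asym _ _ p (to _ Ax))
    ...   | inj₂ from = ⊥-elim (asym _ _ q (from _ Ay))

    autonomous-closed : ∀ {u v w} → A u → A v → v ⟶ w → w ⟶ u → A w
    autonomous-closed {w = w} Au Av v⟶w w⟶u with em (A w)
    ... | yes Aw = Aw
    ... | no ¬Aw with autonomous w ¬Aw
    ...   | inj₁ to   = ⊥-elim (asym _ _ v⟶w (to _ Av))
    ...   | inj₂ from = ⊥-elim (asym _ _ w⟶u (from _ Au))

  -- An autonomous set containing `x` and `y` contains the interval between them, hence two vertices
  -- of the linking 3-cycle, hence the third one as well.
  linked⇒no-edge : AllLinked D → (A : Subset D) → Autonomous D A → AcyclicOn D A →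
    ∀ x y → A x → A y → ¬ (x ⟶ y)
  linked⇒no-edge linked A autonomous acyclic x y Ax Ay x⟶y with linked x y x⟶y
  ... | u , v , w , bu , bv , u⟶v , v⟶w , w⟶u =
    let Au = autonomous-convex A autonomous Ax Ay bu
        Av = autonomous-convex A autonomous Ax Ay bv
        Aw = autonomous-closed A autonomous Au Av v⟶w w⟶u
    in acyclic (u , v , w , Au , Av , Aw , u⟶v , v⟶w , w⟶u)

  linked⇒indecomposable : AllLinked D → AcyclicallyIndecomposable D
  linked⇒indecomposable linked A autonomous acyclic x y Ax Ay with em (x ≡ y)
  ... | yes x≡y = x≡y
  ... | no x≢y with complete x y x≢y
  ...   | inj₁ x⟶y = ⊥-elim (linked⇒no-edge linked A autonomous acyclic x y Ax Ay x⟶y)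
  ...   | inj₂ y⟶x = ⊥-elim (linked⇒no-edge linked A autonomous acyclic y x Ay Ax y⟶x)

  -- A 3-cycle inside the interval is already a link, so without a link the interval is acyclic. It
  -- is then also autonomous, and indecomposability collapses it to a point.
  indecomposable⇒linked : AcyclicallyIndecomposable D → AllLinked D
  indecomposable⇒linked indecomposable x y x⟶y with em (Link D x y)
  ... | yes link = link
  ... | no ¬link = ⊥-elim (irr x (subst (x ⟶_) (sym x≡y) x⟶y))
    where
    below : ∀ {z} → Between D x y z → z ≢ x → x ⟶ z
    below left        z≢x = ⊥-elim (z≢x refl)
    below right       z≢x = x⟶y
    below (inner p q) z≢x = p

    above : ∀ {z} → Between D x y z → z ≢ y → z ⟶ y
    above left        z≢y = x⟶y
    above right       z≢y = ⊥-elim (z≢y refl)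
    above (inner p q) z≢y = q

    -- If `w ⟶ a`, then either `a`, `y`, `w` form a linking 3-cycle or `w` itself falls into the
    -- interval.
    edge-from : ∀ {a w} → x ⟶ w → ¬ Between D x y w → Between D x y a → a ⟶ w
    edge-from {a} {w} x⟶w ¬bw ba with complete a w (λ { refl → ¬bw ba })
    ... | inj₁ a⟶w = a⟶w
    ... | inj₂ w⟶a with complete y w (λ { refl → ¬bw right })
    ...   | inj₁ y⟶w = ⊥-elim (¬link (a , y , w , ba , right
                        , above ba (λ { refl → asym _ _ y⟶w w⟶a }) , y⟶w , w⟶a))
    ...   | inj₂ w⟶y = ⊥-elim (¬bw (inner x⟶w w⟶y))

    -- Here the linking 3-cycle would be `x`, `a`, `w`.
    edge-to : ∀ {a w} → w ⟶ x → ¬ Between D x y w → Between D x y a → w ⟶ a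
    edge-to {a} {w} w⟶x ¬bw ba with complete a w (λ { refl → ¬bw ba })
    ... | inj₂ w⟶a = w⟶a
    ... | inj₁ a⟶w = ⊥-elim (¬link (x , a , w , left , ba
                      , below ba (λ { refl → asym _ _ w⟶x a⟶w }) , a⟶w , w⟶x))

    autonomous : Autonomous D (Between D x y)
    autonomous w ¬bw with complete w x (λ { refl → ¬bw left })
    ... | inj₁ w⟶x = inj₁ (λ a → edge-to w⟶x ¬bw)
    ... | inj₂ x⟶w = inj₂ (λ a → edge-from x⟶w ¬bw)

    x≡y : x ≡ y
    x≡y = indecomposable (Between D x y) autonomous
      (λ { (u , v , w , bu , bv , _ , u⟶v , v⟶w , w⟶u) →
             ¬link (u , v , w , bu , bv , u⟶v , v⟶w , w⟶u) })
      x y left right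

injection⇒infinite : (D : Digraph) (f : ℕ → V D) → Injective _≡_ _≡_ f → Infinite D
injection⇒infinite D f f-inj (n , V↔Fin) =
  ℕ→Fin-notInjective (Inverse.to V↔Fin ∘ f) (λ eq → f-inj (to-injective eq))
  where
  to-injective : Injective _≡_ _≡_ (Inverse.to V↔Fin)
  to-injective {a} {b} eq =
    trans (sym (Inverse.strictlyInverseʳ V↔Fin a))
          (trans (cong (Inverse.from V↔Fin) eq) (Inverse.strictlyInverseʳ V↔Fin b))

Induced-isTournament : (D : Digraph) (P : V D → Set) → IsTournament D →
  (∀ {v} (p q : P v) → p ≡ q) → IsTournament (Induced D P)
Induced-isTournament D P (irr , asym , complete) P-irrelevant =
    (λ { (u , _) → irr u })
  , (λ { (u , _) (v , _) → asym u v })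
  , (λ { (u , p) (v , q) u≢v → complete u v
           (λ { refl → u≢v (cong (u ,_) (P-irrelevant p q)) }) })

-- The basic tournaments

module _ {A : Set} {_<ᶜ_ : A → A → Set} (isOrder : IsStrictTotalOrder _≡_ _<ᶜ_) where
  private
    module O = IsStrictTotalOrder isOrder
    irr : ∀ {x} → ¬ (x <ᶜ x)
    irr = O.irrefl refl

  C3dot-isTournament : IsTournament (C3dot A _<ᶜ_)
  C3dot-isTournament = irreflexive , asymmetric , complete
    where
    D = C3dot A _<ᶜ_

    irreflexive : ∀ u → ¬ (_⇒_ D u u)
    irreflexive (x , i)  (inj₁ x<x)      = irr x<x
    irreflexive (x , 0F) (inj₂ (_ , ()))
    irreflexive (x , 1F) (inj₂ (_ , ()))
    irreflexive (x , 2F) (inj₂ (_ , ()))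

    asymmetric : ∀ u v → _⇒_ D u v → ¬ (_⇒_ D v u)
    asymmetric _ _ (inj₁ x<y) (inj₁ y<x) = O.asym x<y y<x
    asymmetric _ _ (inj₁ x<y) (inj₂ (refl , _)) = irr x<y
    asymmetric _ _ (inj₂ (refl , _)) (inj₁ y<x) = irr y<x
    asymmetric (x , 0F) _ (inj₂ (refl , refl)) (inj₂ (_ , ()))
    asymmetric (x , 1F) _ (inj₂ (refl , refl)) (inj₂ (_ , ()))
    asymmetric (x , 2F) _ (inj₂ (refl , refl)) (inj₂ (_ , ()))

    complete : ∀ u v → u ≢ v → _⇒_ D u v ⊎ _⇒_ D v u
    complete (x , i) (y , j) u≢v with O.compare x y
    ... | tri< x<y _ _ = inj₁ (inj₁ x<y)
    ... | tri> _ _ y<x = inj₂ (inj₁ y<x)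
    complete (x , 0F) (y , 0F) u≢v | tri≈ _ refl _ = ⊥-elim (u≢v refl)
    complete (x , 1F) (y , 1F) u≢v | tri≈ _ refl _ = ⊥-elim (u≢v refl)
    complete (x , 2F) (y , 2F) u≢v | tri≈ _ refl _ = ⊥-elim (u≢v refl)
    complete (x , 0F) (y , 1F) u≢v | tri≈ _ refl _ = inj₁ (inj₂ (refl , refl))
    complete (x , 1F) (y , 2F) u≢v | tri≈ _ refl _ = inj₁ (inj₂ (refl , refl))
    complete (x , 2F) (y , 0F) u≢v | tri≈ _ refl _ = inj₁ (inj₂ (refl , refl))
    complete (x , 1F) (y , 0F) u≢v | tri≈ _ refl _ = inj₂ (inj₂ (refl , refl))
    complete (x , 2F) (y , 1F) u≢v | tri≈ _ refl _ = inj₂ (inj₂ (refl , refl))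
    complete (x , 0F) (y , 2F) u≢v | tri≈ _ refl _ = inj₂ (inj₂ (refl , refl))

  succ3³ : ∀ i → i ≡ succ3 (succ3 (succ3 i))
  succ3³ 0F = refl
  succ3³ 1F = refl
  succ3³ 2F = refl

  C3dot-linked : AllLinked (C3dot A _<ᶜ_)
  C3dot-linked (x , i) (y , j) (inj₁ x<y) =
    (x , i) , (x , succ3 i) , (x , succ3 (succ3 i))
    , left , inner (inj₂ (refl , refl)) (inj₁ x<y)
    , inj₂ (refl , refl) , inj₂ (refl , refl) , inj₂ (refl , succ3³ i)
  C3dot-linked (x , i) (x , _) (inj₂ (refl , refl)) =
    (x , i) , (x , succ3 i) , (x , succ3 (succ3 i)) , left , right
    , inj₂ (refl , refl) , inj₂ (refl , refl) , inj₂ (refl , succ3³ i)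

  VC-isTournament : IsTournament (VC A _<ᶜ_)
  VC-isTournament = irreflexive , asymmetric , complete
    where
    D = VC A _<ᶜ_

    irreflexive : ∀ u → ¬ (_⇒_ D u u)
    irreflexive (just (x , i)) (inj₁ x<x) = irr x<x
    irreflexive (just (x , i)) (inj₂ (_ , refl , ()))

    asymmetric : ∀ u v → _⇒_ D u v → ¬ (_⇒_ D v u)
    asymmetric (just _) (just _) (inj₁ x<y) (inj₁ y<x) = O.asym x<y y<x
    asymmetric (just _) (just _) (inj₁ x<y) (inj₂ (refl , _)) = irr x<y
    asymmetric (just _) (just _) (inj₂ (refl , _)) (inj₁ y<x) = irr y<x
    asymmetric (just _) (just _) (inj₂ (refl , refl , refl)) (inj₂ (_ , () , _))
    asymmetric nothing (just _) refl ()
    asymmetric (just _) nothing refl ()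

    complete : ∀ u v → u ≢ v → _⇒_ D u v ⊎ _⇒_ D v u
    complete nothing nothing u≢v = ⊥-elim (u≢v refl)
    complete nothing (just (_ , 0F)) _ = inj₁ refl
    complete nothing (just (_ , 1F)) _ = inj₂ refl
    complete (just (_ , 0F)) nothing _ = inj₂ refl
    complete (just (_ , 1F)) nothing _ = inj₁ refl
    complete (just (x , i)) (just (y , j)) u≢v with O.compare x y
    ... | tri< x<y _ _ = inj₁ (inj₁ x<y)
    ... | tri> _ _ y<x = inj₂ (inj₁ y<x)
    complete (just (x , 0F)) (just (y , 0F)) u≢v | tri≈ _ refl _ = ⊥-elim (u≢v refl)
    complete (just (x , 1F)) (just (y , 1F)) u≢v | tri≈ _ refl _ = ⊥-elim (u≢v refl)
    complete (just (x , 0F)) (just (y , 1F)) u≢v | tri≈ _ refl _ = inj₁ (inj₂ (refl , refl , refl))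
    complete (just (x , 1F)) (just (y , 0F)) u≢v | tri≈ _ refl _ = inj₂ (inj₂ (refl , refl , refl))

  VC-linked : AllLinked (VC A _<ᶜ_)
  VC-linked nothing (just (x , _)) refl =
    nothing , just (x , 0F) , just (x , 1F) , left , right , refl , inj₂ (refl , refl , refl) , refl
  VC-linked (just (x , _)) nothing refl =
    just (x , 1F) , nothing , just (x , 0F) , left , right , refl , refl , inj₂ (refl , refl , refl)
  VC-linked (just (x , _)) (just (x , _)) (inj₂ (refl , refl , refl)) =
    just (x , 0F) , just (x , 1F) , nothing , left , right , inj₂ (refl , refl , refl) , refl , refl
  VC-linked (just (x , 0F)) (just (y , j)) (inj₁ x<y) =
    just (x , 0F) , just (x , 1F) , nothing , left , inner (inj₂ (refl , refl , refl)) (inj₁ x<y)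
    , inj₂ (refl , refl , refl) , refl , refl
  VC-linked (just (x , 1F)) (just (y , 1F)) (inj₁ x<y) =
    just (y , 0F) , just (y , 1F) , nothing , inner (inj₁ x<y) (inj₂ (refl , refl , refl)) , right
    , inj₂ (refl , refl , refl) , refl , refl
  -- The new vertex lies strictly between the two ends.
  VC-linked (just (x , 1F)) (just (y , 0F)) (inj₁ x<y) =
    nothing , just (y , 0F) , just (y , 1F) , inner refl refl , right
    , refl , inj₂ (refl , refl , refl) , refl

  TwoLayer-isTournament : (fwd : Fin 2 → Fin 2 → Bool) → IsTournament (TwoLayer fwd A _<ᶜ_)
  TwoLayer-isTournament fwd = irreflexive , asymmetric , complete
    where
    D = TwoLayer fwd A _<ᶜ_

    T-not : ∀ b → T b → ¬ T (not b)
    T-not false ()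
    T-not true _ ()

    irreflexive : ∀ u → ¬ (_⇒_ D u u)
    irreflexive (x , i) (inj₁ (_ , refl , ()))
    irreflexive (x , i) (inj₂ (inj₁ (x<x , _))) = irr x<x
    irreflexive (x , i) (inj₂ (inj₂ (x<x , _))) = irr x<x

    asymmetric : ∀ u v → _⇒_ D u v → ¬ (_⇒_ D v u)
    asymmetric _ _ (inj₁ (refl , refl , refl)) (inj₁ (_ , () , _))
    asymmetric _ _ (inj₁ (refl , _)) (inj₂ (inj₁ (y<x , _))) = irr y<x
    asymmetric _ _ (inj₁ (refl , _)) (inj₂ (inj₂ (x<y , _))) = irr x<y
    asymmetric _ _ (inj₂ (inj₁ (x<y , _))) (inj₁ (refl , _)) = irr x<y
    asymmetric _ _ (inj₂ (inj₁ (x<y , _))) (inj₂ (inj₁ (y<x , _))) = O.asym x<y y<x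
    asymmetric (_ , i) (_ , j) (inj₂ (inj₁ (_ , t))) (inj₂ (inj₂ (_ , f))) = T-not (fwd i j) t f
    asymmetric _ _ (inj₂ (inj₂ (y<x , _))) (inj₁ (refl , _)) = irr y<x
    asymmetric (_ , i) (_ , j) (inj₂ (inj₂ (_ , f))) (inj₂ (inj₁ (_ , t))) = T-not (fwd j i) t f
    asymmetric _ _ (inj₂ (inj₂ (y<x , _))) (inj₂ (inj₂ (x<y , _))) = O.asym x<y y<x

    T-or-not : ∀ b → T b ⊎ T (not b)
    T-or-not false = inj₂ tt
    T-or-not true  = inj₁ tt

    complete : ∀ u v → u ≢ v → _⇒_ D u v ⊎ _⇒_ D v u
    complete (x , i) (y , j) u≢v with O.compare x y
    complete (x , i) (y , j) u≢v | tri< x<y _ _ with T-or-not (fwd i j)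
    ... | inj₁ t = inj₁ (inj₂ (inj₁ (x<y , t)))
    ... | inj₂ f = inj₂ (inj₂ (inj₂ (x<y , f)))
    complete (x , i) (y , j) u≢v | tri> _ _ y<x with T-or-not (fwd j i)
    ... | inj₁ t = inj₂ (inj₂ (inj₁ (y<x , t)))
    ... | inj₂ f = inj₁ (inj₂ (inj₂ (y<x , f)))
    complete (x , 0F) (y , 0F) u≢v | tri≈ _ refl _ = ⊥-elim (u≢v refl)
    complete (x , 1F) (y , 1F) u≢v | tri≈ _ refl _ = ⊥-elim (u≢v refl)
    complete (x , 0F) (y , 1F) u≢v | tri≈ _ refl _ = inj₁ (inj₁ (refl , refl , refl))
    complete (x , 1F) (y , 0F) u≢v | tri≈ _ refl _ = inj₂ (inj₁ (refl , refl , refl))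

pattern rung    = inj₁ (refl , refl , refl)
pattern up lt   = inj₂ (inj₁ (lt , tt))
pattern down lt = inj₂ (inj₂ (lt , tt))

module _ {A : Set} {_<ᶜ_ : A → A → Set} (isOrder : IsStrictTotalOrder _≡_ _<ᶜ_) where
  private
    <ᶜ-trans : ∀ {x y z} → x <ᶜ y → y <ᶜ z → x <ᶜ z
    <ᶜ-trans = IsStrictTotalOrder.trans isOrder

  -- Only rungs and edges from `(y , 0F)` to `(x , 1F)` take their third vertex from a further
  -- index; one unbounded side of the order provides it.
  TC-linked : (∀ x → ∃[ z ] x <ᶜ z) ⊎ (∀ x → ∃[ z ] z <ᶜ x) → AllLinked (TC A _<ᶜ_)
  TC-linked (inj₁ above) (x , 0F) (x , 1F) rung with above x
  ... | z , x<z = (x , 0F) , (x , 1F) , (z , 1F) , left , right , rung , up x<z , down x<z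
  TC-linked (inj₂ below) (x , 0F) (x , 1F) rung with below x
  ... | z , z<x = (x , 0F) , (x , 1F) , (z , 0F) , left , right , rung , down z<x , up z<x
  TC-linked _ (x , 0F) (y , 0F) (up x<y) =
    (x , 0F) , (y , 0F) , (y , 1F) , left , right , up x<y , rung , down x<y
  TC-linked _ (x , 1F) (y , 1F) (up x<y) =
    (x , 1F) , (y , 1F) , (x , 0F) , left , right , up x<y , down x<y , rung
  TC-linked (inj₁ above) (y , 0F) (x , 1F) (down x<y) with above y
  ... | z , y<z = (y , 0F) , (x , 1F) , (z , 1F) , left , right
                , down x<y , up (<ᶜ-trans x<y y<z) , down y<z
  TC-linked (inj₂ below) (y , 0F) (x , 1F) (down x<y) with below x
  ... | z , z<x = (y , 0F) , (x , 1F) , (z , 0F) , left , right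
                , down x<y , down z<x , up (<ᶜ-trans z<x x<y)
  TC-linked _ (y , 1F) (x , 0F) (down x<y) =
    (y , 1F) , (x , 0F) , (y , 0F) , left , right , down x<y , up x<y , rung

  -- Some edges of U lie in no 3-cycle, for instance `(x , 0F)` to `(y , 0F)`; for these the cycle
  -- passes through an interior vertex of the interval.
  UC-linked : (∀ x → ∃[ z ] x <ᶜ z) ⊎ (∀ x → ∃[ z ] z <ᶜ x) → AllLinked (UC A _<ᶜ_)
  -- Only some `(z , 1F)` with `z` below `x` closes a 3-cycle on a rung. With `z` above `x`, the
  -- vertex `(z , 1F)` lies inside the rung's interval instead.
  UC-linked (inj₁ above) (x , 0F) (x , 1F) rung with above x
  ... | z , x<z = (z , 1F) , (x , 1F) , (z , 0F) , inner (up x<z) (down x<z) , right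
                , down x<z , up x<z , rung
  UC-linked (inj₂ below) (x , 0F) (x , 1F) rung with below x
  ... | z , z<x = (x , 0F) , (x , 1F) , (z , 1F) , left , right , rung , down z<x , up z<x
  UC-linked _ (x , 0F) (y , 0F) (up x<y) =
    (x , 1F) , (y , 0F) , (y , 1F) , inner rung (up x<y) , right , up x<y , rung , down x<y
  UC-linked _ (y , 1F) (x , 1F) (down x<y) =
    (y , 1F) , (x , 1F) , (y , 0F) , left , right , down x<y , up x<y , rung
  UC-linked _ (x , 0F) (y , 1F) (up x<y) =
    (y , 0F) , (y , 1F) , (x , 1F) , inner (up x<y) rung , right , rung , down x<y , up x<y
  UC-linked _ (x , 1F) (y , 0F) (up x<y) =
    (x , 1F) , (y , 0F) , (y , 1F) , left , right , up x<y , rung , down x<y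

  HC-linked : (∀ x → ∃[ z ] x <ᶜ z) ⊎ (∀ x → ∃[ z ] z <ᶜ x) → AllLinked (HC A _<ᶜ_)
  HC-linked (inj₁ above) (x , 0F) (x , 1F) rung with above x
  ... | z , x<z = (x , 0F) , (x , 1F) , (z , 1F) , left , right , rung , up x<z , down x<z
  HC-linked (inj₂ below) (x , 0F) (x , 1F) rung with below x
  ... | z , z<x = (x , 0F) , (x , 1F) , (z , 0F) , left , right , rung , down z<x , up z<x
  HC-linked _ (x , 0F) (y , 1F) (inj₂ (inj₁ (_ , ())))
  HC-linked _ (x , 0F) (y , 1F) (inj₂ (inj₂ (_ , ())))
  HC-linked _ (x , 0F) (y , 0F) (up x<y) =
    (x , 0F) , (y , 0F) , (y , 1F) , left , right , up x<y , rung , down x<y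
  HC-linked _ (x , 1F) (y , 1F) (up x<y) =
    (x , 1F) , (y , 1F) , (x , 0F) , left , right , up x<y , down x<y , rung
  HC-linked _ (y , 1F) (x , 0F) (down x<y) =
    (y , 1F) , (x , 0F) , (y , 0F) , left , right , down x<y , up x<y , rung
  -- This edge lies in no 3-cycle. The link uses an interior vertex: `(z , 1F)` beyond `y`, or
  -- `(z , 0F)` before `x`.
  HC-linked (inj₁ above) (x , 1F) (y , 0F) (up x<y) with above y
  ... | z , y<z = (x , 1F) , (z , 1F) , (x , 0F) , left , inner (up (<ᶜ-trans x<y y<z)) (down y<z)
                , up (<ᶜ-trans x<y y<z) , down (<ᶜ-trans x<y y<z) , rung
  HC-linked (inj₂ below) (x , 1F) (y , 0F) (up x<y) with below x
  ... | z , z<x = (z , 0F) , (y , 0F) , (y , 1F) , inner (down z<x) (up (<ᶜ-trans z<x x<y)) , right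
                , up (<ᶜ-trans z<x x<y) , rung , down (<ᶜ-trans z<x x<y)

  -- In K the third vertex of a 3-cycle on a rung always has a smaller index, so the hypothesis
  -- looks downwards.
  KC-linked : (∀ x → ∃[ z ] z <ᶜ x) → AllLinked (KC A _<ᶜ_)
  KC-linked below (x , 0F) (x , 1F) rung with below x
  ... | z , z<x = (x , 0F) , (x , 1F) , (z , 0F) , left , right , rung , down z<x , up z<x
  KC-linked _ (x , 0F) (y , 0F) (up x<y) =
    (x , 0F) , (y , 0F) , (y , 1F) , left , right , up x<y , rung , down x<y
  KC-linked _ (y , 1F) (x , 1F) (down x<y) =
    (y , 1F) , (x , 1F) , (y , 0F) , left , right , down x<y , up x<y , rung
  KC-linked _ (x , 0F) (y , 1F) (inj₂ (inj₁ (_ , ())))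
  KC-linked _ (x , 0F) (y , 1F) (inj₂ (inj₂ (_ , ())))
  KC-linked _ (y , 1F) (x , 0F) (down x<y) =
    (y , 1F) , (x , 0F) , (y , 0F) , left , right , down x<y , up x<y , rung
  KC-linked _ (x , 1F) (y , 0F) (up x<y) =
    (x , 1F) , (y , 0F) , (y , 1F) , left , right , up x<y , rung , down x<y

-- The rung at 0 < x uses the surviving vertex (0 , 1) below it; in K_[ω] itself the rung
-- at 0 lies in no 3-cycle and spans an autonomous pair, whence the deletion of (0 , 0).
KCheckω-linked : AllLinked KCheckω
KCheckω-linked ((zero  , 0F) , p) ((_ , 1F) , q) rung = ⊥-elim (p refl)
KCheckω-linked ((suc x , 0F) , p) ((_ , 1F) , q) rung =
  ((suc x , 0F) , p) , ((suc x , 1F) , q) , ((0 , 1F) , λ ()) , left , right , rung , down z<s , up z<s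
KCheckω-linked ((x , 0F) , p) ((y , 0F) , q) (up x<y) =
  ((x , 0F) , p) , ((y , 0F) , q) , ((y , 1F) , λ ()) , left , right , up x<y , rung , down x<y
KCheckω-linked ((suc y , 1F) , p) ((x , 1F) , q) (down x<y) =
  ((suc y , 1F) , p) , ((x , 1F) , q) , ((suc y , 0F) , λ ()) , left , right , down x<y , up x<y , rung
KCheckω-linked ((zero , 1F) , p) ((x , 1F) , q) (inj₂ (inj₁ (_ , ())))
KCheckω-linked ((x , 0F) , p) ((y , 1F) , q) (inj₂ (inj₁ (_ , ())))
KCheckω-linked ((x , 0F) , p) ((y , 1F) , q) (inj₂ (inj₂ (_ , ())))
KCheckω-linked ((suc y , 1F) , p) ((x , 0F) , q) (down x<y) =
  ((suc y , 1F) , p) , ((x , 0F) , q) , ((suc y , 0F) , λ ()) , left , right , down x<y , up x<y , rung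
KCheckω-linked ((x , 1F) , p) ((y , 0F) , q) (up x<y) =
  ((x , 1F) , p) , ((y , 0F) , q) , ((y , 1F) , λ ()) , left , right , up x<y , rung , down x<y

<ω*-isStrictTotalOrder : IsStrictTotalOrder _≡_ _<ω*_
<ω*-isStrictTotalOrder = flip-isStrictTotalOrder <-isStrictTotalOrder

next : ∀ x → ∃[ y ] x < y
next x = suc x , n<1+n x

basic-isTournament : ∀ b → IsTournament (basic b)
basic-isTournament c3ω  = C3dot-isTournament <-isStrictTotalOrder
basic-isTournament c3ω* = C3dot-isTournament <ω*-isStrictTotalOrder
basic-isTournament vω   = VC-isTournament <-isStrictTotalOrder
basic-isTournament vω*  = VC-isTournament <ω*-isStrictTotalOrder
basic-isTournament tω   = TwoLayer-isTournament <-isStrictTotalOrder fwdT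
basic-isTournament tω*  = TwoLayer-isTournament <ω*-isStrictTotalOrder fwdT
basic-isTournament uω   = TwoLayer-isTournament <-isStrictTotalOrder fwdU
basic-isTournament uω*  = TwoLayer-isTournament <ω*-isStrictTotalOrder fwdU
basic-isTournament hω   = TwoLayer-isTournament <-isStrictTotalOrder fwdH
basic-isTournament hω*  = TwoLayer-isTournament <ω*-isStrictTotalOrder fwdH
basic-isTournament ǩω   = Induced-isTournament (KC ℕ _<ω_) (_≢ (0 , 0F))
  (TwoLayer-isTournament <-isStrictTotalOrder fwdK) (λ _ _ → refl)
basic-isTournament kω*  = TwoLayer-isTournament <ω*-isStrictTotalOrder fwdK

basic-linked : ∀ b → AllLinked (basic b)
basic-linked c3ω  = C3dot-linked <-isStrictTotalOrder
basic-linked c3ω* = C3dot-linked <ω*-isStrictTotalOrder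
basic-linked vω   = VC-linked <-isStrictTotalOrder
basic-linked vω*  = VC-linked <ω*-isStrictTotalOrder
basic-linked tω   = TC-linked <-isStrictTotalOrder (inj₁ next)
basic-linked tω*  = TC-linked <ω*-isStrictTotalOrder (inj₂ next)
basic-linked uω   = UC-linked <-isStrictTotalOrder (inj₁ next)
basic-linked uω*  = UC-linked <ω*-isStrictTotalOrder (inj₂ next)
basic-linked hω   = HC-linked <-isStrictTotalOrder (inj₁ next)
basic-linked hω*  = HC-linked <ω*-isStrictTotalOrder (inj₂ next)
basic-linked ǩω   = KCheckω-linked
basic-linked kω*  = KC-linked <ω*-isStrictTotalOrder next

basic-infinite : ∀ b → Infinite (basic b)
basic-infinite c3ω  = injection⇒infinite (basic c3ω) (_, 0F) (cong proj₁)
basic-infinite c3ω* = injection⇒infinite (basic c3ω*) (_, 0F) (cong proj₁)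
basic-infinite vω   = injection⇒infinite (basic vω) (λ n → just (n , 0F)) (λ { refl → refl })
basic-infinite vω*  = injection⇒infinite (basic vω*) (λ n → just (n , 0F)) (λ { refl → refl })
basic-infinite tω   = injection⇒infinite (basic tω) (_, 0F) (cong proj₁)
basic-infinite tω*  = injection⇒infinite (basic tω*) (_, 0F) (cong proj₁)
basic-infinite uω   = injection⇒infinite (basic uω) (_, 0F) (cong proj₁)
basic-infinite uω*  = injection⇒infinite (basic uω*) (_, 0F) (cong proj₁)
basic-infinite hω   = injection⇒infinite (basic hω) (_, 0F) (cong proj₁)
basic-infinite hω*  = injection⇒infinite (basic hω*) (_, 0F) (cong proj₁)
basic-infinite ǩω   = injection⇒infinite (basic ǩω) (λ n → (n , 1F) , λ ()) (cong (proj₁ ∘ proj₁))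
basic-infinite kω*  = injection⇒infinite (basic kω*) (_, 0F) (cong proj₁)

-- Ramsey's theorem and infinite sequences

StrictlyIncreasing : (ℕ → ℕ) → Set
StrictlyIncreasing s = ∀ {i j} → i < j → s i < s j

steps-increasing : (s : ℕ → ℕ) → (∀ i → s i < s (suc i)) → StrictlyIncreasing s
steps-increasing s step {i} {suc j} i<1+j with m<1+n⇒m<n∨m≡n i<1+j
... | inj₁ i<j  = <-trans (steps-increasing s step i<j) (step j)
... | inj₂ refl = step j

module Ramsey (em : ExcludedMiddle) where

  -- Either `P` fails from some `N` on, and shifting by `N` suffices, or every bound is passed by a
  -- witness and iterated search collects them.
  constant-subsequence : (P : ℕ → Set) →
    ∃[ s ] StrictlyIncreasing s × ((∀ i → P (s i)) ⊎ (∀ i → ¬ P (s i)))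
  constant-subsequence P with em (Σ[ N ∈ ℕ ] (∀ n → N ≤ n → ¬ P n))
  ... | yes (N , none) = (_+ N) , +-monoˡ-< N , inj₂ (λ i → none (i + N) (m≤n+m N i))
  ... | no unbounded = s , steps-increasing s (λ i → proj₁ (proj₂ (find (suc (s i))))) , inj₁ holds
    where
    find : ∀ N → Σ[ n ∈ ℕ ] (N ≤ n × P n)
    find N with em (Σ[ n ∈ ℕ ] (N ≤ n × P n))
    ... | yes found = found
    ... | no ¬found = ⊥-elim (unbounded (N , λ n N≤n Pn → ¬found (n , N≤n , Pn)))
    s : ℕ → ℕ
    s zero    = proj₁ (find 0)
    s (suc i) = proj₁ (find (suc (s i)))
    holds : ∀ i → P (s i)
    holds zero    = proj₂ (proj₂ (find 0))
    holds (suc i) = proj₂ (proj₂ (find (suc (s i))))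

  module _ (R : ℕ → ℕ → Set) where
    private
      thinning : (s : ℕ → ℕ) → _
      thinning s = constant-subsequence (λ n → R (s 0) (s (suc n)))

      -- Nested subsequences: from `S k` the head `x k` is dropped and the tail thinned until
      -- `R (x k)` is constant along it.
      S : ℕ → ℕ → ℕ
      S zero    = id
      S (suc k) = S k ∘ suc ∘ proj₁ (thinning (S k))

      S-increasing : ∀ k → StrictlyIncreasing (S k)
      S-increasing zero    i<j = i<j
      S-increasing (suc k) i<j = S-increasing k (s<s (proj₁ (proj₂ (thinning (S k))) i<j))

      x : ℕ → ℕ
      x k = S k 0

      x-increasing : StrictlyIncreasing x
      x-increasing = steps-increasing x (λ k → S-increasing k z<s)

      S-nested : ∀ {k l} → k ≤′ l → ∀ n → ∃[ m ] S l n ≡ S k m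
      S-nested ≤′-refl         n = n , refl
      S-nested (≤′-step k≤′l) n = S-nested k≤′l _

    -- Each head `x k` has one fixed relation to all later heads; a last thinning makes that
    -- relation the same for all `k`.
    ramsey : ∃[ s ] StrictlyIncreasing s
      × ((∀ {i j} → i < j → R (s i) (s j)) ⊎ (∀ {i j} → i < j → ¬ R (s i) (s j)))
    ramsey with constant-subsequence (λ k → ∀ i → R (x k) (S (suc k) i))
    ... | s , s-inc , inj₁ all = x ∘ s , x-increasing ∘ s-inc , inj₁ related
      where
      related : ∀ {i j} → i < j → R (x (s i)) (x (s j))
      -- By nesting, the later head is a term of the sequence on which `R (x (s i))` is constant.
      related {i} {j} i<j with S-nested (≤⇒≤′ (s-inc i<j)) 0
      ... | m , eq = subst (R (x (s i))) (sym eq) (all i m)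
    ... | s , s-inc , inj₂ none = x ∘ s , x-increasing ∘ s-inc , inj₂ unrelated
      where
      unrelated : ∀ {i j} → i < j → ¬ R (x (s i)) (x (s j))
      unrelated {i} {j} i<j r with S-nested (≤⇒≤′ (s-inc i<j)) 0 | proj₂ (proj₂ (thinning (S (s i))))
      ... | m , eq | inj₁ all = none i all
      ... | m , eq | inj₂ not = not m (subst (R (x (s i))) eq r)

module _ (em : ExcludedMiddle) (D : Digraph) (infinite : Infinite D) where
  private
    lookup-injective : {xs : List (V D)} → Unique xs → ∀ i j → lookup xs i ≡ lookup xs j → i ≡ j
    lookup-injective (_ ∷ _)  zero    zero    _  = refl
    lookup-injective (x≢ ∷ _) zero    (suc j) eq = ⊥-elim (All.lookup x≢ (∈-lookup j) eq)
    lookup-injective (x≢ ∷ _) (suc i) zero    eq = ⊥-elim (All.lookup x≢ (∈-lookup i) (sym eq))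
    lookup-injective (_ ∷ un) (suc i) (suc j) eq = cong suc (lookup-injective un i j eq)

    -- A repetition-free list of all vertices would make `index` and `lookup` inverse bijections
    -- with a finite set.
    fresh : (xs : List (V D)) → Unique xs → Σ[ v ∈ V D ] v ∉ xs
    fresh xs un with em (Σ[ v ∈ V D ] v ∉ xs)
    ... | yes found = found
    ... | no ¬found = ⊥-elim (infinite (length xs , mk↔ₛ′ (index ∘ listed) (lookup xs)
            (λ i → lookup-injective un _ i (sym (lookup-index (listed (lookup xs i)))))
            (λ v → sym (lookup-index (listed v)))))
      where
      listed : ∀ v → v ∈ xs
      listed v with em (v ∈ xs)
      ... | yes v∈xs = v∈xs
      ... | no v∉xs  = ⊥-elim (¬found (v , v∉xs))

    prefix : ℕ → Σ (List (V D)) Unique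
    prefix zero    = [] , []
    prefix (suc n) with prefix n
    ... | xs , un with fresh xs un
    ...   | v , v∉xs = v ∷ xs , All.tabulate (λ { y∈xs refl → v∉xs y∈xs }) ∷ un

  infinite⇒injection : Σ[ e ∈ (ℕ → V D) ] (∀ i j → i < j → e i ≢ e j)
  infinite⇒injection = e , distinct
    where
    e : ℕ → V D
    e n = proj₁ (fresh (proj₁ (prefix n)) (proj₂ (prefix n)))
    earlier : ∀ {i j} → suc i ≤′ j → e i ∈ proj₁ (prefix j)
    earlier ≤′-refl        = here refl
    earlier (≤′-step i<′j) = there (earlier i<′j)
    distinct : ∀ i j → i < j → e i ≢ e j
    distinct i j i<j eq = proj₂ (fresh (proj₁ (prefix j)) (proj₂ (prefix j)))
      (subst (_∈ proj₁ (prefix j)) eq (earlier (≤⇒≤′ i<j)))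

-- Duality and directions between sequences

dual : Digraph → Digraph
dual D = record { V = V D ; _⇒_ = flip (_⇒_ D) }

dual-isTournament : {D : Digraph} → IsTournament D → IsTournament (dual D)
dual-isTournament (irr , asym , complete) =
  irr , (λ u v → asym v u) , (λ u v u≢v → swap (complete u v u≢v))

dual-indecomposable : {D : Digraph} → AcyclicallyIndecomposable D → AcyclicallyIndecomposable (dual D)
dual-indecomposable indecomposable A autonomous acyclic =
  indecomposable A (λ w ¬Aw → swap (autonomous w ¬Aw))
    (λ { (x , y , z , Ax , Ay , Az , x⟶y , y⟶z , z⟶x) →
         acyclic (z , y , x , Az , Ay , Ax , y⟶z , x⟶y , z⟶x) })

-- Nothing is said about equal indices: the edges there are the rungs and cycles, recorded
-- separately.
Dir : (D : Digraph) → Bool → (f g : ℕ → V D) → Set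
Dir D true  f g = ∀ i j → i < j → _⇒_ D (f i) (g j)
Dir D false f g = ∀ i j → i < j → _⇒_ D (g j) (f i)

dual-Dir : (D : Digraph) → ∀ b {f g} → Dir (dual D) b f g → Dir D (not b) f g
dual-Dir D true  d = d
dual-Dir D false d = d

elim₂ : {P : Fin 2 → Fin 2 → Set} → P 0F 0F → P 0F 1F → P 1F 0F → P 1F 1F → ∀ i j → P i j
elim₂ p _ _ _ 0F 0F = p
elim₂ _ p _ _ 0F 1F = p
elim₂ _ _ p _ 1F 0F = p
elim₂ _ _ _ p 1F 1F = p

pair : {A : Set} → A → A → Fin 2 → A
pair f g 0F = f
pair f g 1F = g

-- Patterns and their realisations

-- With directions k₀₀, k₀₁, k₁₀, k₁₁ and rungs f i → g i, these are the ten two-layer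
-- tournaments which contain 3-cycles.
cyclic : (k₀₀ k₀₁ k₁₀ k₁₁ : Bool) → Bool
cyclic true  k₀₁ k₁₀ k₁₁ = not k₀₁ ∨ (k₁₀ ∧ not k₁₁)
cyclic false k₀₁ k₁₀ k₁₁ = k₁₀ ∨ (not k₀₁ ∧ k₁₁)

cyclic-dual : ∀ k₀₀ k₀₁ k₁₀ k₁₁ → T (cyclic k₀₀ k₀₁ k₁₀ k₁₁) →
  T (cyclic (not k₁₁) (not k₁₀) (not k₀₁) (not k₀₀))
cyclic-dual true  false true  true  _ = tt
cyclic-dual true  false true  false _ = tt
cyclic-dual true  false false true  _ = tt
cyclic-dual true  false false false _ = tt
cyclic-dual true  true  true  false _ = tt
cyclic-dual false true  true  true  _ = tt
cyclic-dual false true  true  false _ = tt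
cyclic-dual false false true  true  _ = tt
cyclic-dual false false true  false _ = tt
cyclic-dual false false false true  _ = tt

data Pattern (D : Digraph) : Set where
  layers : (f g : ℕ → V D) → (∀ i → _⇒_ D (f i) (g i)) →
    ∀ k₀₀ k₀₁ k₁₀ k₁₁ → T (cyclic k₀₀ k₀₁ k₁₀ k₁₁) →
    Dir D k₀₀ f f → Dir D k₀₁ f g → Dir D k₁₀ g f → Dir D k₁₁ g g → Pattern D
  vee    : ∀ d (z : V D) (f g : ℕ → V D) → (∀ i → _⇒_ D (f i) (g i)) →
    (∀ i → _⇒_ D z (f i)) → (∀ i → _⇒_ D (g i) z) →
    Dir D d f f → Dir D d f g → Dir D d g f → Dir D d g g → Pattern D
  cycles : ∀ d (h : Fin 3 → ℕ → V D) → (∀ i n → _⇒_ D (h i n) (h (succ3 i) n)) →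
    (∀ i j → Dir D d (h i) (h j)) → Pattern D

-- An odd relabelling, which turns a reversed 3-cycle back into one running along `succ3`.
mirror : Fin 3 → Fin 3
mirror 0F = 0F
mirror 1F = 2F
mirror 2F = 1F

-- Reversing the rungs exchanges the two layers, so the direction flags are negated and also
-- permuted.
dual-Pattern : (D : Digraph) → Pattern (dual D) → Pattern D
dual-Pattern D (layers f g f⟶g k₀₀ k₀₁ k₁₀ k₁₁ cyc d₀₀ d₀₁ d₁₀ d₁₁) =
  layers g f f⟶g (not k₁₁) (not k₁₀) (not k₀₁) (not k₀₀) (cyclic-dual k₀₀ k₀₁ k₁₀ k₁₁ cyc)
    (dual-Dir D k₁₁ d₁₁) (dual-Dir D k₁₀ d₁₀) (dual-Dir D k₀₁ d₀₁) (dual-Dir D k₀₀ d₀₀)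
dual-Pattern D (vee d z f g f⟶g z⟶f g⟶z d₀₀ d₀₁ d₁₀ d₁₁) =
  vee (not d) z g f f⟶g g⟶z z⟶f
    (dual-Dir D d d₁₁) (dual-Dir D d d₁₀) (dual-Dir D d d₀₁) (dual-Dir D d d₀₀)
dual-Pattern D (cycles d h cycle dir) =
  cycles (not d) (h ∘ mirror)
    (λ { 0F → cycle 2F ; 1F → cycle 1F ; 2F → cycle 0F })
    (λ i j → dual-Dir D d (dir (mirror i) (mirror j)))

module Realisation (em : ExcludedMiddle) (D : Digraph) (tournament : IsTournament D) where
  private
    _⟶_ : V D → V D → Set
    _⟶_ = _⇒_ D
    irr  = proj₁ tournament
    asym = proj₁ (proj₂ tournament)

  -- Any two distinct vertices of `S` are joined by an edge. Its image cannot be a loop, which gives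
  -- injectivity, nor be reversed, which gives reflection. Patterns therefore need to record edges
  -- only.
  edge-preserving⇒embeds : (S : Digraph) → IsTournament S → (f : V S → V D) →
    (∀ u v → _⇒_ S u v → f u ⟶ f v) → Embeds S D
  edge-preserving⇒embeds S (S-irr , _ , S-complete) f preserves = record
    { f = f ; inj = λ {u} {v} → injective u v ; edges = λ u v → mk⇔ (preserves u v) (reflects u v) }
    where
    injective : ∀ u v → f u ≡ f v → u ≡ v
    injective u v eq with em (u ≡ v)
    ... | yes u≡v = u≡v
    ... | no u≢v with S-complete u v u≢v
    ...   | inj₁ u⇒v = ⊥-elim (irr (f v) (subst (_⟶ f v) eq (preserves u v u⇒v)))
    ...   | inj₂ v⇒u = ⊥-elim (irr (f v) (subst (f v ⟶_) eq (preserves v u v⇒u)))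
    reflects : ∀ u v → f u ⟶ f v → _⇒_ S u v
    reflects u v e with em (u ≡ v)
    ... | yes refl = ⊥-elim (irr (f u) e)
    ... | no u≢v with S-complete u v u≢v
    ...   | inj₁ u⇒v = u⇒v
    ...   | inj₂ v⇒u = ⊥-elim (asym _ _ e (preserves v u v⇒u))

  basic-embeds : ∀ b (f : V (basic b) → V D) →
    (∀ u v → _⇒_ (basic b) u v → f u ⟶ f v) → ∃[ c ] Embeds (basic c) D
  basic-embeds b f preserves =
    b , edge-preserving⇒embeds (basic b) (basic-isTournament b) f preserves

  module _ (fwd : Fin 2 → Fin 2 → Bool) (f g : ℕ → V D) (f⟶g : ∀ i → f i ⟶ g i) where

    layered : ℕ × Fin 2 → V D
    layered (n , i) = pair f g i n

    layered-preserves-ω : (∀ i j → Dir D (fwd i j) (pair f g i) (pair f g j)) →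
      ∀ u v → _⇒_ (TwoLayer fwd ℕ _<ω_) u v → layered u ⟶ layered v
    layered-preserves-ω dir _ _ rung = f⟶g _
    layered-preserves-ω dir (x , i) (y , j) (inj₂ (inj₁ (x<y , t))) with fwd i j | dir i j
    ... | true | d = d x y x<y
    layered-preserves-ω dir (x , i) (y , j) (inj₂ (inj₂ (y<x , t))) with fwd j i | dir j i
    ... | false | d = d y x y<x

    -- In ω* the earlier index is the larger number, whereas `Dir` lists the smaller first; hence
    -- the negation and the exchanged layers.
    layered-preserves-ω* : (∀ i j → Dir D (not (fwd i j)) (pair f g j) (pair f g i)) →
      ∀ u v → _⇒_ (TwoLayer fwd ℕ _<ω*_) u v → layered u ⟶ layered v
    layered-preserves-ω* dir _ _ rung = f⟶g _
    layered-preserves-ω* dir (x , i) (y , j) (inj₂ (inj₁ (y<x , t))) with fwd i j | dir i j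
    ... | true | d = d y x y<x
    layered-preserves-ω* dir (x , i) (y , j) (inj₂ (inj₂ (x<y , t))) with fwd j i | dir j i
    ... | false | d = d x y x<y

  -- The directions (1,0,0,0) and (0,1,1,1) are not among the basic ones: after shifting one
  -- layer by one step they turn into those of U_[ω*] and U_[ω].
  realise : Pattern D → ∃[ b ] Embeds (basic b) D
  realise (layers f g f⟶g true false false true _ d₀₀ d₀₁ d₁₀ d₁₁) =
    basic-embeds tω _ (layered-preserves-ω fwdT f g f⟶g (elim₂ d₀₀ d₀₁ d₁₀ d₁₁))
  realise (layers f g f⟶g true false true true _ d₀₀ d₀₁ d₁₀ d₁₁) =
    basic-embeds hω _ (layered-preserves-ω fwdH f g f⟶g (elim₂ d₀₀ d₀₁ d₁₀ d₁₁))
  realise (layers f g f⟶g true false true false _ d₀₀ d₀₁ d₁₀ d₁₁) =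
    -- The pattern yields all of K_[ω]; `proj₁` restricts it to the vertices other than `(0 , 0F)`.
    basic-embeds ǩω (layered fwdK f g f⟶g ∘ proj₁) λ (u , _) (v , _) →
      layered-preserves-ω fwdK f g f⟶g (elim₂ d₀₀ d₀₁ d₁₀ d₁₁) u v
  realise (layers f g f⟶g true true true false _ d₀₀ d₀₁ d₁₀ d₁₁) =
    basic-embeds uω _ (layered-preserves-ω fwdU f g f⟶g (elim₂ d₀₀ d₀₁ d₁₀ d₁₁))
  realise (layers f g f⟶g false true true false _ d₀₀ d₀₁ d₁₀ d₁₁) =
    basic-embeds tω* _ (layered-preserves-ω* fwdT f g f⟶g (elim₂ d₀₀ d₁₀ d₀₁ d₁₁))
  realise (layers f g f⟶g false false true false _ d₀₀ d₀₁ d₁₀ d₁₁) =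
    basic-embeds hω* _ (layered-preserves-ω* fwdH f g f⟶g (elim₂ d₀₀ d₁₀ d₀₁ d₁₁))
  realise (layers f g f⟶g false false true true _ d₀₀ d₀₁ d₁₀ d₁₁) =
    basic-embeds kω* _ (layered-preserves-ω* fwdK f g f⟶g (elim₂ d₀₀ d₁₀ d₀₁ d₁₁))
  realise (layers f g f⟶g false false false true _ d₀₀ d₀₁ d₁₀ d₁₁) =
    basic-embeds uω* _ (layered-preserves-ω* fwdU f g f⟶g (elim₂ d₀₀ d₁₀ d₀₁ d₁₁))
  realise (layers f g f⟶g true false false false _ d₀₀ d₀₁ d₁₀ d₁₁) =
    realise (layers (g ∘ suc) f (λ i → d₀₁ i (suc i) (n<1+n i)) false false false true tt
      (λ i j i<j → d₁₁ (suc i) (suc j) (s<s i<j)) backward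
      (λ i j i<j → d₀₁ i (suc j) (m<n⇒m<1+n i<j)) d₀₀)
    where
    -- At `j = suc i` the required edge is the old rung at `suc i`; the new rungs came from `d₀₁`.
    backward : Dir D false (g ∘ suc) f
    backward i j i<j with m≤n⇒m<n∨m≡n i<j
    ... | inj₁ 1+i<j = d₁₀ (suc i) j 1+i<j
    ... | inj₂ refl  = f⟶g (suc i)
  realise (layers f g f⟶g false true true true _ d₀₀ d₀₁ d₁₀ d₁₁) =
    realise (layers g (f ∘ suc) (λ i → d₁₀ i (suc i) (n<1+n i)) true true true false tt
      d₁₁ (λ i j i<j → d₁₀ i (suc j) (m<n⇒m<1+n i<j)) forward
      (λ i j i<j → d₀₀ (suc i) (suc j) (s<s i<j)))
    where
    forward : Dir D true (f ∘ suc) g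
    forward i j i<j with m≤n⇒m<n∨m≡n i<j
    ... | inj₁ 1+i<j = d₀₁ (suc i) j 1+i<j
    ... | inj₂ refl  = f⟶g (suc i)
  realise (vee true z f g f⟶g z⟶f g⟶z d₀₀ d₀₁ d₁₀ d₁₁) = basic-embeds vω F preserves
    where
    F : Maybe (ℕ × Fin 2) → V D
    F nothing        = z
    F (just (n , i)) = pair f g i n
    preserves : ∀ u v → _⇒_ (basic vω) u v → F u ⟶ F v
    preserves nothing (just _) refl = z⟶f _
    preserves (just _) nothing refl = g⟶z _
    preserves (just _) (just _) (inj₂ (refl , refl , refl)) = f⟶g _
    preserves (just (_ , i)) (just (_ , j)) (inj₁ x<y) =
      elim₂ {λ i j → Dir D true (pair f g i) (pair f g j)} d₀₀ d₀₁ d₁₀ d₁₁ i j _ _ x<y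
  realise (vee false z f g f⟶g z⟶f g⟶z d₀₀ d₀₁ d₁₀ d₁₁) = basic-embeds vω* F preserves
    where
    F : Maybe (ℕ × Fin 2) → V D
    F nothing        = z
    F (just (n , i)) = pair f g i n
    preserves : ∀ u v → _⇒_ (basic vω*) u v → F u ⟶ F v
    preserves nothing (just _) refl = z⟶f _
    preserves (just _) nothing refl = g⟶z _
    preserves (just _) (just _) (inj₂ (refl , refl , refl)) = f⟶g _
    preserves (just (_ , i)) (just (_ , j)) (inj₁ y<x) =
      elim₂ {λ i j → Dir D false (pair f g i) (pair f g j)} d₀₀ d₀₁ d₁₀ d₁₁ j i _ _ y<x
  realise (cycles true h cycle dir) = basic-embeds c3ω (λ (n , i) → h i n) preserves
    where
    preserves : ∀ u v → _⇒_ (basic c3ω) u v → h (proj₂ u) (proj₁ u) ⟶ h (proj₂ v) (proj₁ v)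
    preserves (x , i) (y , j) (inj₁ x<y) = dir i j x y x<y
    preserves (x , i) (x , _) (inj₂ (refl , refl)) = cycle i x
  realise (cycles false h cycle dir) = basic-embeds c3ω* (λ (n , i) → h i n) preserves
    where
    preserves : ∀ u v → _⇒_ (basic c3ω*) u v → h (proj₂ u) (proj₁ u) ⟶ h (proj₂ v) (proj₁ v)
    preserves (x , i) (y , j) (inj₁ y<x) = dir j i y x y<x
    preserves (x , i) (x , _) (inj₂ (refl , refl)) = cycle i x

double : ℕ → ℕ
double zero    = zero
double (suc n) = suc (suc (double n))

double-< : ∀ {i j} → i < j → suc (double i) < double j
double-< {zero}  {suc j} _         = s<s z<s
double-< {suc i} {suc j} (s≤s i<j) = s<s (s<s (double-< i<j))

elim₃ : {P : Fin 3 → Fin 3 → Set} →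
  P 0F 0F → P 0F 1F → P 0F 2F → P 1F 0F → P 1F 1F → P 1F 2F → P 2F 0F → P 2F 1F → P 2F 2F →
  ∀ i j → P i j
elim₃ p _ _ _ _ _ _ _ _ 0F 0F = p
elim₃ _ p _ _ _ _ _ _ _ 0F 1F = p
elim₃ _ _ p _ _ _ _ _ _ 0F 2F = p
elim₃ _ _ _ p _ _ _ _ _ 1F 0F = p
elim₃ _ _ _ _ p _ _ _ _ 1F 1F = p
elim₃ _ _ _ _ _ p _ _ _ 1F 2F = p
elim₃ _ _ _ _ _ _ p _ _ 2F 0F = p
elim₃ _ _ _ _ _ _ _ p _ 2F 1F = p
elim₃ _ _ _ _ _ _ _ _ p 2F 2F = p

triple : {A : Set} → A → A → A → Fin 3 → A
triple a b c 0F = a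
triple a b c 1F = b
triple a b c 2F = c

-- Homogeneous sequences along a chain

module Chains (em : ExcludedMiddle) (D : Digraph) (tournament : IsTournament D) where
  open Ramsey em
  private
    _⟶_ : V D → V D → Set
    _⟶_ = _⇒_ D
    irr      = proj₁ tournament
    asym     = proj₁ (proj₂ tournament)
    complete = proj₂ (proj₂ tournament)

    Seq : Set
    Seq = ℕ → V D

    _⇉_ : Seq → Seq → Set
    f ⇉ g = Dir D true f g

    restrict : ∀ b {f g : Seq} {s} → StrictlyIncreasing s → Dir D b f g → Dir D b (f ∘ s) (g ∘ s)
    restrict true  inc d i j i<j = d _ _ (inc i<j)
    restrict false inc d i j i<j = d _ _ (inc i<j)

  -- Terms of the two sequences may coincide, as when all the `wᵢ` are one vertex, so a third
  -- outcome is needed besides the two directions.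
  data Compared (f g : Seq) : Set where
    directed  : ∀ b → Dir D b f g → Compared f g
    identical : (∀ i j → i < j → f i ≡ g j) → Compared f g

  restrict-Compared : ∀ {f g : Seq} {s} → StrictlyIncreasing s → Compared f g → Compared (f ∘ s) (g ∘ s)
  restrict-Compared inc (directed b d) = directed b (restrict b inc d)
  restrict-Compared inc (identical e)  = identical (λ i j i<j → e _ _ (inc i<j))

  compare : ∀ (f g : Seq) → ∃[ s ] StrictlyIncreasing s × Compared (f ∘ s) (g ∘ s)
  compare f g with ramsey (λ i j → f i ⟶ g j)
  ... | s , s-inc , inj₁ to = s , s-inc , directed true (λ i j → to)
  ... | s , s-inc , inj₂ ¬to with ramsey (λ i j → g (s j) ⟶ f (s i))
  ...   | t , t-inc , inj₁ from = s ∘ t , s-inc ∘ t-inc , directed false (λ i j → from)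
  ...   | t , t-inc , inj₂ ¬from = s ∘ t , s-inc ∘ t-inc , identical equal
    where
    equal : ∀ i j → i < j → f (s (t i)) ≡ g (s (t j))
    equal i j i<j with em (f (s (t i)) ≡ g (s (t j)))
    ... | yes eq = eq
    ... | no ne with complete _ _ ne
    ...   | inj₁ to   = ⊥-elim (¬to (t-inc i<j) to)
    ...   | inj₂ from = ⊥-elim (¬from i<j from)

  compare-all : {I : Set} (F : I → Seq) (L : List (I × I)) →
    ∃[ s ] StrictlyIncreasing s × (∀ {p q} → (p , q) ∈ L → Compared (F p ∘ s) (F q ∘ s))
  compare-all F [] = id , id , λ ()
  compare-all F ((p , q) ∷ L) with compare-all F L
  ... | s , s-inc , compared with compare (F p ∘ s) (F q ∘ s)
  ...   | t , t-inc , compared-pq = s ∘ t , s-inc ∘ t-inc , λ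
    { (here refl) → compared-pq
    ; (there pq∈L) → restrict-Compared t-inc (compared pq∈L) }

  homogenise : ∀ {n} (F : Fin n → Seq) →
    ∃[ s ] StrictlyIncreasing s × (∀ p q → Compared (F p ∘ s) (F q ∘ s))
  homogenise {n} F with compare-all F (cartesianProduct (allFin n) (allFin n))
  ... | s , s-inc , compared =
    s , s-inc , λ p q → compared (∈-cartesianProduct⁺ (∈-allFin p) (∈-allFin q))

  distinct : ∀ b {f : Seq} → Dir D b f f → ∀ i j → i < j → f i ≢ f j
  distinct true  {f} d i j i<j eq = irr (f j) (subst (_⟶ f j) eq (d i j i<j))
  distinct false {f} d i j i<j eq = irr (f j) (subst (f j ⟶_) eq (d i j i<j))

  identical-target : ∀ {f g : Seq} → (∀ i j → i < j → f i ≡ g j) → g 1 ≡ g 2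
  identical-target e = trans (sym (e 0 1 z<s)) (e 0 2 z<s)

  identical-source : ∀ {f g : Seq} → (∀ i j → i < j → f i ≡ g j) → f 0 ≡ f 1
  identical-source e = trans (e 0 2 z<s) (sym (e 1 2 (s<s z<s)))

  -- `identical` would make `f` repeat a value, which a sequence directed towards itself cannot do.
  directionˡ : ∀ {f g : Seq} b → Dir D b f f → Compared f g → Σ[ k ∈ Bool ] Dir D k f g
  directionˡ b ff (directed k d) = k , d
  directionˡ b ff (identical e)  = ⊥-elim (distinct b ff 0 1 z<s (identical-source e))

  directionʳ : ∀ {f g : Seq} b → Dir D b g g → Compared f g → Σ[ k ∈ Bool ] Dir D k f g
  directionʳ b gg (directed k d) = k , d
  directionʳ b gg (identical e)  = ⊥-elim (distinct b gg 1 2 (s<s z<s) (identical-target e))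

  first : ∀ {f g} → (∀ i → f i ⟶ g i) → f ⇉ g → ∀ j → f 0 ⟶ g j
  first f⟶g fg zero    = f⟶g 0
  first f⟶g fg (suc j) = fg 0 (suc j) z<s

  -- 3-cycles over an interleaved chain

  module Triples (a b c : Seq)
    (a⟶b : ∀ i → a i ⟶ b i) (b⟶c : ∀ i → b i ⟶ c i) (c⟶a : ∀ i → c i ⟶ a i)
    (aa : a ⇉ a) (ab : a ⇉ b) (ba : b ⇉ a) (bb : b ⇉ b) where

    -- A backward `ca` or `bc` gives two layers with the rungs `c⟶a` or `b⟶c`. Otherwise a backward
    -- `cb` makes `c 0` the apex of a V, a backward `cc` gives U_[ω] on `b` and `c`, and a backward
    -- `ac` makes `a 0` the apex of a V. If all directions are forward, the 3-cycles form C₃.ω.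
    triples-spread : (k : Bool) → Dir D k c c →
      Compared c a → Compared a c → Compared b c → Compared c b → Pattern D
    triples-spread k cc ca? ac? bc? cb?
      with directionʳ true aa ca? | directionˡ true aa ac? | directionˡ true bb bc? | directionʳ true bb cb?
    triples-spread true  cc _ _ _ _ | false , ca | kac , ac | _ | _ =
      layers c a c⟶a true false kac true tt cc ca ac aa
    triples-spread false cc _ _ _ _ | false , ca | true , ac | _ | _ =
      layers c a c⟶a false false true true tt cc ca ac aa
    triples-spread false cc _ _ _ _ | false , ca | false , ac | _ | _ =
      layers c a c⟶a false false false true tt cc ca ac aa
    triples-spread k     cc _ _ _ _ | true , ca | _ | false , bc | kcb , cb =
      layers b c b⟶c true false kcb k tt bb bc cb cc
    triples-spread k     cc _ _ _ _ | true , ca | _ | true , bc | false , cb =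
      vee true (c 0) a b a⟶b (first c⟶a ca) b⟶c₀ aa ab ba bb
      where
      b⟶c₀ : ∀ i → b i ⟶ c 0
      b⟶c₀ zero    = b⟶c 0
      b⟶c₀ (suc i) = cb 0 (suc i) z<s
    triples-spread false cc _ _ _ _ | true , ca | _ | true , bc | true , cb =
      layers b c b⟶c true true true false tt bb bc cb cc
    triples-spread true  cc _ _ _ _ | true , ca | true , ac | true , bc | true , cb =
      cycles true (triple a b c) (λ { 0F → a⟶b ; 1F → b⟶c ; 2F → c⟶a })
        (elim₃ aa ab ac ba bb bc ca cb cc)
    triples-spread true  cc _ _ _ _ | true , ca | false , ac | true , bc | true , cb =
      vee true (a 0) b c b⟶c (first a⟶b ab) c⟶a₀ bb bc cb cc
      where
      c⟶a₀ : ∀ i → c i ⟶ a 0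
      c⟶a₀ zero    = c⟶a 0
      c⟶a₀ (suc i) = ac 0 (suc i) z<s

    triples : Compared c c → Compared c a → Compared a c → Compared b c → Compared c b → Pattern D
    triples (directed k cc) ca? ac? bc? cb? = triples-spread k cc ca? ac? bc? cb?
    -- Every later `c` equals `c 0`, which is the apex of a V. Index 0 is skipped because `e` speaks
    -- only of `i < j`.
    triples (identical e) _ _ _ _ = vee true (c 0) (a ∘ suc) (b ∘ suc) (a⟶b ∘ suc)
      (λ i → subst (_⟶ a (suc i)) (sym (e 0 (suc i) z<s)) (c⟶a (suc i)))
      (λ i → subst (b (suc i) ⟶_) (sym (e 0 (suc i) z<s)) (b⟶c (suc i)))
      (restrict true s<s aa) (restrict true s<s ab) (restrict true s<s ba) (restrict true s<s bb)

  -- What passes to subsequences from `z i` lying in an interval that starts at `l i`: towards the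
  -- other terms of `l` it behaves as `l i` does.
  record Between-chain (l z : Seq) : Set where
    field
      below  : ∀ i → l i ≡ z i ⊎ l i ⟶ z i
      before : l ⇉ z
      after  : z ⇉ l

  open Between-chain

  restrict-Between-chain : ∀ {l z s} → StrictlyIncreasing s →
    Between-chain l z → Between-chain (l ∘ s) (z ∘ s)
  restrict-Between-chain {s = s} inc bet = record
    { below  = below bet ∘ s
    ; before = restrict true inc (before bet)
    ; after  = restrict true inc (after bet) }

  -- The term `l 1` separates them: `y 0 ⟶ l 1` and `l 1 ⟶ z 2`.
  interleaved-distinct : ∀ {l y z} → Between-chain l y → Between-chain l z → y 0 ≢ z 2
  interleaved-distinct {l} {y} {z} bet-y bet-z eq =
    asym _ _ (after bet-y 0 1 z<s) (subst (l 1 ⟶_) (sym eq) (before bet-z 1 2 (s<s z<s)))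

  -- A backward `z` forms U_[ω] together with `l`; coincidences are excluded because terms of `l`
  -- separate those of `z`.
  increasing-or-pattern : ∀ {l z} → l ⇉ l → Between-chain l z → Compared z z → z ⇉ z ⊎ Pattern D
  increasing-or-pattern ll bet (directed true zz) = inj₁ zz
  increasing-or-pattern ll bet (identical e) = ⊥-elim (interleaved-distinct bet bet (e 0 2 z<s))
  increasing-or-pattern {l} {z} ll bet (directed false zz) =
    inj₂ (layers l z l⟶z true true true false tt ll (before bet) (after bet) zz)
    where
    l⟶z : ∀ i → l i ⟶ z i
    l⟶z i with below bet i
    ... | inj₂ li⟶zi = li⟶zi
    -- If `z i` were `l i`, it would dominate `z (suc i)`, against the backward direction of `z`.
    ... | inj₁ li≡zi = ⊥-elim (asym _ _ (zz i (suc i) (n<1+n i))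
                         (subst (_⟶ z (suc i)) li≡zi (before bet i (suc i) (n<1+n i))))

  -- The position of `w` is unrestricted; it may even be constant.
  record Gaps : Set where
    field
      l u v w : Seq
      ll      : l ⇉ l
      bet-u   : Between-chain l u
      bet-v   : Between-chain l v
      u⟶v     : ∀ i → u i ⟶ v i
      v⟶w     : ∀ i → v i ⟶ w i
      w⟶u     : ∀ i → w i ⟶ u i

  restrict-Gaps : ∀ {s} → StrictlyIncreasing s → Gaps → Gaps
  restrict-Gaps {s} inc G = record
    { l = l ∘ s ; u = u ∘ s ; v = v ∘ s ; w = w ∘ s
    ; ll = restrict true inc ll
    ; bet-u = restrict-Between-chain inc bet-u ; bet-v = restrict-Between-chain inc bet-v
    ; u⟶v = u⟶v ∘ s ; v⟶w = v⟶w ∘ s ; w⟶u = w⟶u ∘ s }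
    where open Gaps G

  module _ (G : Gaps) where
    open Gaps G

    homogeneous-gaps⇒pattern :
      (∀ p q → Compared (triple u v w p) (triple u v w q)) → Pattern D
    homogeneous-gaps⇒pattern compared
      with increasing-or-pattern ll bet-u (compared 0F 0F) | increasing-or-pattern ll bet-v (compared 1F 1F)
    ... | inj₂ pattern-u | _ = pattern-u
    ... | inj₁ _ | inj₂ pattern-v = pattern-v
    ... | inj₁ uu | inj₁ vv with compared 0F 1F | directionˡ true vv (compared 1F 0F)
    ...   | identical e | _ = ⊥-elim (interleaved-distinct bet-u bet-v (e 0 2 z<s))
    ...   | directed false uv | kvu , vu = layers u v u⟶v true false kvu true tt uu uv vu vv
    ...   | directed true uv | true , vu =
      Triples.triples u v w u⟶v v⟶w w⟶u uu uv vu vv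
        (compared 2F 2F) (compared 2F 0F) (compared 0F 2F) (compared 1F 2F) (compared 2F 1F)
    -- Now `v 0` dominates every later `l` and is dominated by every later `u`, so it is the apex of
    -- a V with rungs from `l` to `u`.
    ...   | directed true uv | false , vu =
      vee true (v 0) (l ∘ suc) (u ∘ suc) l⟶u
        (λ i → after bet-v 0 (suc i) z<s) (λ i → vu 0 (suc i) z<s)
        (restrict true s<s ll) (restrict true s<s (before bet-u))
        (restrict true s<s (after bet-u)) (restrict true s<s uu)
      where
      l⟶u : ∀ i → l (suc i) ⟶ u (suc i)
      l⟶u i with below bet-u (suc i)
      ... | inj₂ l⟶u = l⟶u
      ... | inj₁ l≡u = ⊥-elim (asym _ _ (vu 0 (suc i) z<s)
                         (subst (v 0 ⟶_) l≡u (after bet-v 0 (suc i) z<s)))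

  -- Not a with-abstraction, which would unfold homogenise at the literal 3 and explode.
  gaps⇒pattern : Gaps → Pattern D
  gaps⇒pattern G = from (homogenise F)
    where
    open Gaps G
    F = triple u v w
    from : ∃[ s ] StrictlyIncreasing s × (∀ p q → Compared (F p ∘ s) (F q ∘ s)) → Pattern D
    from (s , s-inc , compared) = homogeneous-gaps⇒pattern (restrict-Gaps s-inc G)
      (elim₃ (compared 0F 0F) (compared 0F 1F) (compared 0F 2F)
             (compared 1F 0F) (compared 1F 1F) (compared 1F 2F)
             (compared 2F 0F) (compared 2F 1F) (compared 2F 2F))

  -- From a chain to 3-cycles in its gaps

  Cyc : V D → V D → Set
  Cyc x y = Σ[ w ∈ V D ] (y ⟶ w × w ⟶ x)

  module _ (linked : AllLinked D) (x : Seq) (xx : x ⇉ x) where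
    private
      p q : Seq
      -- Pairing consecutive terms gives the intervals disjoint ends, so that even the right end
      -- `q i` has an edge to each later `p j`.
      p = x ∘ double
      q = x ∘ suc ∘ double

      p⟶q : ∀ i → p i ⟶ q i
      p⟶q i = xx _ _ (n<1+n _)

      pp : p ⇉ p
      pp i j i<j = xx _ _ (<-trans (n<1+n _) (double-< i<j))

      qp : q ⇉ p
      qp i j i<j = xx _ _ (double-< i<j)

      pq : p ⇉ q
      pq i j i<j = xx _ _ (m<n⇒m<1+n (<-trans (n<1+n _) (double-< i<j)))

    -- The ends `p i` and `q i` themselves serve as the first two vertices of a 3-cycle.
    cyclic-chain⇒gaps : (∀ i j → i < j → Cyc (x i) (x j)) → Gaps
    cyclic-chain⇒gaps cyc = record
      { l = p ; u = p ; v = q ; w = λ i → proj₁ (third i) ; ll = pp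
      ; bet-u = record { below = λ _ → inj₁ refl ; before = pp ; after = pp }
      ; bet-v = record { below = λ i → inj₂ (p⟶q i) ; before = pq ; after = qp }
      ; u⟶v = p⟶q ; v⟶w = λ i → proj₁ (proj₂ (third i)) ; w⟶u = λ i → proj₂ (proj₂ (third i)) }
      where
      third : ∀ i → Cyc (p i) (q i)
      third i = cyc _ _ (n<1+n _)

    module _ (acyc : ∀ i j → i < j → ¬ Cyc (x i) (x j)) where

      -- An interior vertex with a wrongly directed edge would close a 3-cycle on two chain terms:
      -- on `p i` and `p j` for `before`, on `q i` and `p j` for `after`.
      between-chain : (z : Seq) → (∀ i → Between D (p i) (q i) (z i)) → Between-chain p z
      between-chain z bet = record
        { below = λ i → below′ (bet i)
        ; before = λ i j i<j → before′ i<j (bet j)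
        ; after = λ i j i<j → after′ i<j (bet i) }
        where
        below′ : ∀ {i z} → Between D (p i) (q i) z → p i ≡ z ⊎ p i ⟶ z
        below′ left        = inj₁ refl
        below′ right       = inj₂ (p⟶q _)
        below′ (inner e _) = inj₂ e

        before′ : ∀ {i j z} → i < j → Between D (p j) (q j) z → p i ⟶ z
        before′ i<j left  = pp _ _ i<j
        before′ i<j right = pq _ _ i<j
        before′ {i} {j} {z} i<j (inner pj⟶z _)
          with complete (p i) z (λ { refl → asym _ _ (pp i j i<j) pj⟶z })
        ... | inj₁ pi⟶z = pi⟶z
        ... | inj₂ z⟶pi = ⊥-elim (acyc _ _ (<-trans (n<1+n _) (double-< i<j)) (z , pj⟶z , z⟶pi))

        after′ : ∀ {i j z} → i < j → Between D (p i) (q i) z → z ⟶ p j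
        after′ i<j left  = pp _ _ i<j
        after′ i<j right = qp _ _ i<j
        after′ {i} {j} {z} i<j (inner _ z⟶qi)
          with complete z (p j) (λ { refl → asym _ _ (qp i j i<j) z⟶qi })
        ... | inj₁ z⟶pj = z⟶pj
        ... | inj₂ pj⟶z = ⊥-elim (acyc _ _ (double-< i<j) (z , pj⟶z , z⟶qi))

      acyclic-chain⇒gaps : Gaps
      acyclic-chain⇒gaps = record
        { l = p ; u = λ i → proj₁ (link i) ; v = λ i → proj₁ (proj₂ (link i))
        ; w = λ i → proj₁ (proj₂ (proj₂ (link i))) ; ll = pp
        ; bet-u = between-chain _ (λ i → proj₁ (proj₂ (proj₂ (proj₂ (link i)))))
        ; bet-v = between-chain _ (λ i → proj₁ (proj₂ (proj₂ (proj₂ (proj₂ (link i))))))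
        ; u⟶v = λ i → proj₁ (proj₂ (proj₂ (proj₂ (proj₂ (proj₂ (link i))))))
        ; v⟶w = λ i → proj₁ (proj₂ (proj₂ (proj₂ (proj₂ (proj₂ (proj₂ (link i)))))))
        ; w⟶u = λ i → proj₂ (proj₂ (proj₂ (proj₂ (proj₂ (proj₂ (proj₂ (link i))))))) }
        where
        link : ∀ i → Link D (p i) (q i)
        link i = linked (p i) (q i) (p⟶q i)

  chain⇒pattern : AllLinked D → (x : Seq) → x ⇉ x → Pattern D
  chain⇒pattern linked x xx with ramsey (λ i j → Cyc (x i) (x j))
  ... | s , s-inc , inj₁ cyc =
    gaps⇒pattern (cyclic-chain⇒gaps linked (x ∘ s) (restrict true s-inc xx) (λ _ _ → cyc))
  ... | s , s-inc , inj₂ acyc =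
    gaps⇒pattern (acyclic-chain⇒gaps linked (x ∘ s) (restrict true s-inc xx) (λ _ _ → acyc))

-- Choice of a monotone chain and conclusion

indecomposable⇒pattern : ExcludedMiddle → (D : Digraph) → IsTournament D → Infinite D →
  AcyclicallyIndecomposable D → Pattern D
indecomposable⇒pattern em D tournament infinite indecomposable
  with infinite⇒injection em D infinite
... | e , e-distinct with Chains.compare em D tournament e e
...   | s , s-inc , Chains.directed true xx =
  Chains.chain⇒pattern em D tournament
    (indecomposable⇒linked em D tournament indecomposable) (e ∘ s) xx
...   | s , s-inc , Chains.directed false xx =
  -- A backward chain is a forward one in the dual, and the pattern found there is carried back.
  dual-Pattern D (Chains.chain⇒pattern em (dual D) (dual-isTournament tournament)
    (indecomposable⇒linked em (dual D) (dual-isTournament tournament)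
      (dual-indecomposable indecomposable)) (e ∘ s) xx)
...   | s , s-inc , Chains.identical eq = ⊥-elim (e-distinct _ _ (s-inc z<s) (eq 0 1 z<s))

theorem1p2 : ExcludedMiddle →
    ((b : Basic) → IsTournament (basic b) × Infinite (basic b) × AcyclicallyIndecomposable (basic b))
    × ((D : Digraph) → IsTournament D → Infinite D → AcyclicallyIndecomposable D →
    ∃[ b ] Embeds (basic b) D)
theorem1p2 em =
    (λ b → basic-isTournament b , basic-infinite b
         , linked⇒indecomposable em (basic b) (basic-isTournament b) (basic-linked b))
  , (λ D tournament infinite indecomposable → Realisation.realise em D tournament
       (indecomposable⇒pattern em D tournament infinite indecomposable))
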